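{- Let $(T,\mu,\eta)$ be an ordered saturation monad on $\mathsf{Set}$ such that arbitrary cotupling in $\mathcal{K}l(T)$ is monotonic and $T$ weakly lax preserves pullbacks. Then for every $\alpha:X\to TX$, the greatest weak bisimulation $\approx_*$ on $\alpha$ coincides with the greatest strong (Aczel–Mendler) bisimulation on $\alpha^*:X\to TX$.
   Context: Kleisli category $\mathcal{K}l(T)$: morphisms $X\rightsquigarrow Y$ are maps $X\to TY$, composition $g\cdot f=\mu_Z\circ Tg\circ f$, identity $1_X=\eta_X$; $f^\sharp=\eta_Y\circ f$. Ordered saturation monad: $\mathcal{K}l(T)$ order enriched and for each $\alpha:X\rightsquigarrow X$ there is $\alpha^*$ with (1) $1\le\alpha^*$; (2) $\alpha\le\alpha^*$; (3) $\alpha^*\cdot\alpha^*\le\alpha^*$; (4) $\alpha^*\le\beta$ whenever $1\le\beta$, $\alpha\le\beta$, $\beta\cdot\beta\le\beta$; (5) for any map $f:X\to Y$ and $\beta:Y\rightsquigarrow Y$, $f^\sharp\cdot\alpha\le\beta\cdot f^\sharp\Rightarrow f^\sharp\cdot\alpha^*\le\beta^*\cdot f^\sharp$, and likewise with $\ge$. Weak bisimulation on $\alpha$: symmetric $R\subseteq X\times X$ with some $\gamma:R\to TR$ such that $\alpha\cdot\pi_1^\sharp\le\pi_1^\sharp\cdot\gamma$ and $\pi_2^\sharp\cdot\gamma\le\alpha^*\cdot\pi_2^\sharp$. A strong bisimulation on $\beta:X\to TX$ is a relation $R\subseteq X\times X$ with some $\gamma:R\to TR$ such that $T\pi_i\circ\gamma=\beta\circ\pi_i$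 for $i=1,2$. Cotupling monotonic: $f_i\le g_i$ for all $i$ implies $[\{f_i\}]\le[\{g_i\}]$ in $\mathcal{K}l(T)$. Weakly lax preserving pullbacks: for every pullback $P$ (projections $p_1,p_2$) of $A\xrightarrow{f}C\xleftarrow{g}B$, the $T$-image square is a weak pullback and for any $q_1:Z\to TA$, $q_2:Z\to TB$ with $Tf\circ q_1\le Tg\circ q_2$ there is $\xi:Z\to TP$ with $q_1\le Tp_1\circ\xi$ and $Tp_2\circ\xi\le q_2$. -}

module Defs where

open import Level using (Level; _⊔_) renaming (suc to lsuc; zero to lzero)
open import Data.Product using (Σ; _×_; _,_; proj₁; proj₂; ∃)
open import Relation.Binary.PropositionalEquality using (_≡_; _≗_)
open import Function using (_∘_; id)

-- Monads on Set (the category of types Set = Set₀).  Equality of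
-- morphisms (functions) is pointwise equality _≗_, since we have no
-- function extensionality.

record Monad : Set₁ where
  field
    T      : Set → Set
    fmap   : {A B : Set} → (A → B) → T A → T B
    η      : {A : Set} → A → T A
    μ      : {A : Set} → T (T A) → T A
    fmap-cong : {A B : Set} {f g : A → B} → f ≗ g → fmap f ≗ fmap g
    fmap-id   : {A : Set} → fmap (id {A = A}) ≗ id
    fmap-∘    : {A B C : Set} (g : B → C) (f : A → B) →
                fmap (g ∘ f) ≗ fmap g ∘ fmap f
    η-nat : {A B : Set} (f : A → B) → fmap f ∘ η ≗ η ∘ f
    μ-nat : {A B : Set} (f : A → B) → fmap f ∘ μ ≗ μ ∘ fmap (fmap f)
    μ-ηˡ : {A : Set} → μ ∘ η {T A} ≗ id
    μ-ηʳ : {A : Set} → μ ∘ fmap (η {A}) ≗ id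
    μ-assoc : {A : Set} → μ ∘ μ {T A} ≗ μ ∘ fmap (μ {A})

  _⇝_ : Set → Set → Set
  X ⇝ Y = X → T Y

  infixr 9 _·_
  _·_ : {X Y Z : Set} → Y ⇝ Z → X ⇝ Y → X ⇝ Z
  g · f = μ ∘ fmap g ∘ f

  𝟙 : {X : Set} → X ⇝ X
  𝟙 = η

  _♯ : {X Y : Set} → (X → Y) → X ⇝ Y
  f ♯ = η ∘ f

record OrderedSaturationMonad : Set₁ where
  field
    monad : Monad
  open Monad monad public
  infix 4 _≤_
  field
    _≤_      : {X Y : Set} → X ⇝ Y → X ⇝ Y → Set
    ≤-resp-≗ : {X Y : Set} {f f' g g' : X ⇝ Y} →
               f ≗ f' → g ≗ g' → f ≤ g → f' ≤ g'
    ≤-refl   : {X Y : Set} {f : X ⇝ Y} → f ≤ f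
    ≤-trans  : {X Y : Set} {f g h : X ⇝ Y} → f ≤ g → g ≤ h → f ≤ h
    ≤-antisym : {X Y : Set} {f g : X ⇝ Y} → f ≤ g → g ≤ f → f ≗ g
    ·-mono   : {X Y Z : Set} {f f' : X ⇝ Y} {g g' : Y ⇝ Z} →
               f ≤ f' → g ≤ g' → g · f ≤ g' · f'
    _*    : {X : Set} → X ⇝ X → X ⇝ X
    sat-1 : {X : Set} (α : X ⇝ X) → 𝟙 ≤ α *
    sat-2 : {X : Set} (α : X ⇝ X) → α ≤ α *
    sat-3 : {X : Set} (α : X ⇝ X) → (α *) · (α *) ≤ α *
    sat-4 : {X : Set} (α β : X ⇝ X) →
            𝟙 ≤ β → α ≤ β → β · β ≤ β → α * ≤ β
    sat-5≤ : {X Y : Set} (f : X → Y) (α : X ⇝ X) (β : Y ⇝ Y) →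
             (f ♯) · α ≤ β · (f ♯) → (f ♯) · (α *) ≤ (β *) · (f ♯)
    sat-5≥ : {X Y : Set} (f : X → Y) (α : X ⇝ X) (β : Y ⇝ Y) →
             β · (f ♯) ≤ (f ♯) · α → (β *) · (f ♯) ≤ (f ♯) · (α *)

module _ (S : OrderedSaturationMonad) where
  open OrderedSaturationMonad S

  -- Arbitrary cotupling in Kl(T) is monotonic.  Coproducts in Set of a
  -- family X : I → Set are Σ I X; the cotuple [{f_i}] sends (i , x) to f_i x.
  CotuplingMonotonic : Set₁
  CotuplingMonotonic =
    (I : Set) (X : I → Set) (Y : Set) (f g : (i : I) → X i ⇝ Y) →
    ((i : I) → f i ≤ g i) →
    _≤_ {Σ I X} {Y} (λ p → f (proj₁ p) (proj₂ p)) (λ p → g (proj₁ p) (proj₂ p))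

  Pullback : {A B C : Set} → (A → C) → (B → C) → Set
  Pullback {A} {B} f g = Σ (A × B) λ ab → f (proj₁ ab) ≡ g (proj₂ ab)

  pb₁ : {A B C : Set} {f : A → C} {g : B → C} → Pullback f g → A
  pb₁ p = proj₁ (proj₁ p)

  pb₂ : {A B C : Set} {f : A → C} {g : B → C} → Pullback f g → B
  pb₂ p = proj₂ (proj₁ p)

  WeaklyLaxPreservesPullbacks : Set₁
  WeaklyLaxPreservesPullbacks =
    {A B C : Set} (f : A → C) (g : B → C) →
    ((Z : Set) (q₁ : Z → T A) (q₂ : Z → T B) →
       fmap f ∘ q₁ ≗ fmap g ∘ q₂ →
       Σ (Z → T (Pullback f g)) λ ξ →
         (fmap pb₁ ∘ ξ ≗ q₁) × (fmap pb₂ ∘ ξ ≗ q₂))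
    ×
    ((Z : Set) (q₁ : Z → T A) (q₂ : Z → T B) →
       _≤_ {Z} {C} (fmap f ∘ q₁) (fmap g ∘ q₂) →
       Σ (Z → T (Pullback f g)) λ ξ →
         (_≤_ {Z} {A} q₁ (fmap pb₁ ∘ ξ)) × (_≤_ {Z} {B} (fmap pb₂ ∘ ξ) q₂))

  Rel : Set → Set₁
  Rel X = X → X → Set

  ∣_∣ : {X : Set} → Rel X → Set
  ∣_∣ {X} R = Σ (X × X) λ xy → R (proj₁ xy) (proj₂ xy)

  π₁ : {X : Set} {R : Rel X} → ∣ R ∣ → X
  π₁ p = proj₁ (proj₁ p)

  π₂ : {X : Set} {R : Rel X} → ∣ R ∣ → X
  π₂ p = proj₂ (proj₁ p)

  Symmetric : {X : Set} → Rel X → Set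
  Symmetric R = ∀ {x y} → R x y → R y x

  IsWeakBisim : {X : Set} → X ⇝ X → Rel X → Set
  IsWeakBisim {X} α R =
    Symmetric R ×
    Σ (∣ R ∣ → T ∣ R ∣) λ γ →
      (α · (π₁ {X} {R} ♯) ≤ (π₁ {X} {R} ♯) · γ) ×
      ((π₂ {X} {R} ♯) · γ ≤ (α *) · (π₂ {X} {R} ♯))

  IsStrongBisim : {X : Set} → (X → T X) → Rel X → Set
  IsStrongBisim {X} β R =
    Σ (∣ R ∣ → T ∣ R ∣) λ γ →
      (fmap (π₁ {X} {R}) ∘ γ ≗ β ∘ π₁ {X} {R}) ×
      (fmap (π₂ {X} {R}) ∘ γ ≗ β ∘ π₂ {X} {R})

  -- The greatest weak bisimulation ≈_* on α (union of all weak bisimulations)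
  WeakBisimilar : {X : Set} → X ⇝ X → X → X → Set₁
  WeakBisimilar α x y = Σ (Rel _) λ R → IsWeakBisim α R × R x y

  -- The greatest strong bisimulation on β (union of all strong bisimulations)
  StronglyBisimilar : {X : Set} → (X → T X) → X → X → Set₁
  StronglyBisimilar β x y = Σ (Rel _) λ R → IsStrongBisim β R × R x y

{-# OPTIONS --safe #-}
module Submission where

open import Defs
open import Data.Bool.Base using (Bool; true; false; not)
open import Data.Product using (Σ; _×_; _,_; proj₁; proj₂)
open import Data.Sum.Base using (_⊎_; inj₁; inj₂; reduce) renaming (map to ⊎-map)
open import Data.Unit.Base using (⊤; tt)
open import Function using (_∘_; id)
open import Relation.Binary.Bundles using (Preorder)
open import Relation.Binary.PropositionalEquality using (_≡_; _≗_; refl; sym; trans; cong)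
import Relation.Binary.Reasoning.Preorder as PreorderReasoning

-- Saturating the flip on Bool × Z and using monotonicity of cotupling gives Kl(T)
-- binary joins f ⊕ g preserved by T.  If a ≤ Tπ ∘ δ, and δ and a agree over T ⊤, then
-- weakly (lax) preserved pullbacks cut δ down to some z ≤ δ with Tπ ∘ z = a: lift
-- inl a ⊕ inr (Tπ ∘ δ) along π and restrict the lift to the left summand.
-- For a weak bisimulation R with witness γ, cutting γ* along π₁ gives z with
-- π₁ z = α* π₁ and π₂ z ≤ α* π₂; by symmetry there is a z' with the projections
-- interchanged, and z'* · z* makes R itself a strong bisimulation on α*.
-- No quotient of X is involved.

-- Order and saturation in the Kleisli category

module KleisliOrder (S : OrderedSaturationMonad) where
  open OrderedSaturationMonad S

  hom-preorder : (X Y : Set) → Preorder _ _ _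
  hom-preorder X Y = record
    { Carrier = X ⇝ Y
    ; _≈_ = _≗_
    ; _≲_ = _≤_
    ; isPreorder = record
      { isEquivalence = record
        { refl = λ _ → refl
        ; sym = λ p x → sym (p x)
        ; trans = λ p q x → trans (p x) (q x)
        }
      ; reflexive = λ p → ≤-resp-≗ (λ _ → refl) p ≤-refl
      ; trans = ≤-trans
      }
    }

  open module ≤-Reasoning {X Y : Set} = PreorderReasoning (hom-preorder X Y) public

  ≗⇒≤ : {X Y : Set} {f g : X ⇝ Y} → f ≗ g → f ≤ g
  ≗⇒≤ p = ≤-resp-≗ (λ _ → refl) p ≤-refl

  ♯-· : {X Y Z : Set} (k : Y → Z) (f : X ⇝ Y) → (k ♯) · f ≗ fmap k ∘ f
  ♯-· k f x = trans (cong μ (fmap-∘ η k (f x))) (μ-ηʳ (fmap k (f x)))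

  ·-♯ : {X Y Z : Set} (g : Y ⇝ Z) (k : X → Y) → g · (k ♯) ≗ g ∘ k
  ·-♯ g k x = trans (cong μ (η-nat g (k x))) (μ-ηˡ (g (k x)))

  ·-identityˡ : {X Y : Set} (f : X ⇝ Y) → 𝟙 · f ≗ f
  ·-identityˡ f x = μ-ηʳ (f x)

  fmap-· : {X Y Z W : Set} (k : Z → W) (g : Y ⇝ Z) (f : X ⇝ Y) →
           fmap k ∘ (g · f) ≗ (fmap k ∘ g) · f
  fmap-· k g f x = trans (μ-nat k _) (cong μ (sym (fmap-∘ (fmap k) g (f x))))

  ·-fmap : {X Y Z W : Set} (g : Z ⇝ W) (k : Y → Z) (f : X ⇝ Y) →
           g · (fmap k ∘ f) ≗ (g ∘ k) · f
  ·-fmap g k f x = cong μ (sym (fmap-∘ g k (f x)))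

  fmap-mono : {X Y Z : Set} (k : Y → Z) {f g : X ⇝ Y} → f ≤ g → fmap k ∘ f ≤ fmap k ∘ g
  fmap-mono k {f} {g} p = ≤-resp-≗ (♯-· k f) (♯-· k g) (·-mono p ≤-refl)

  ∘-mono : {X Y Z : Set} (k : X → Y) {f g : Y ⇝ Z} → f ≤ g → f ∘ k ≤ g ∘ k
  ∘-mono k {f} {g} p = ≤-resp-≗ (·-♯ f k) (·-♯ g k) (·-mono ≤-refl p)

  *-idem : {X : Set} (α : X ⇝ X) → (α *) * ≤ α *
  *-idem α = sat-4 (α *) (α *) (sat-1 α) ≤-refl (sat-3 α)

  -- With `α *` as target, the lifting law for saturation produces `(α *) *`, which idempotence
  -- collapses.
  fmap-*-≤ : {X Y : Set} (f : X → Y) (β : X ⇝ X) (α : Y ⇝ Y) →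
             fmap f ∘ β ≤ α * ∘ f → fmap f ∘ β * ≤ α * ∘ f
  fmap-*-≤ f β α p = begin
    fmap f ∘ β *      ≈⟨ ♯-· f (β *) ⟨
    (f ♯) · (β *)     ≲⟨ sat-5≤ f β (α *) (≤-resp-≗ (λ x → sym (♯-· f β x)) (λ x → sym (·-♯ (α *) f x)) p) ⟩
    ((α *) *) · (f ♯) ≈⟨ ·-♯ ((α *) *) f ⟩
    (α *) * ∘ f       ≲⟨ ∘-mono f (*-idem α) ⟩
    α * ∘ f           ∎

  fmap-*-≥ : {X Y : Set} (f : X → Y) (β : X ⇝ X) (α : Y ⇝ Y) →
             α ∘ f ≤ fmap f ∘ β → α * ∘ f ≤ fmap f ∘ β *
  fmap-*-≥ f β α p =
    ≤-resp-≗ (·-♯ (α *) f) (♯-· f (β *))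
      (sat-5≥ f β α (≤-resp-≗ (λ x → sym (·-♯ α f x)) (λ x → sym (♯-· f β x)) p))

  𝟙*≤𝟙 : {X : Set} → 𝟙 * ≤ 𝟙 {X}
  𝟙*≤𝟙 = sat-4 𝟙 𝟙 ≤-refl ≤-refl (≗⇒≤ (·-identityˡ 𝟙))

-- Binary joins of Kleisli maps

module Join (S : OrderedSaturationMonad) where
  open OrderedSaturationMonad S
  open KleisliOrder S

  flip : {Z : Set} → Bool × Z → Bool × Z
  flip (b , z) = not b , z

  -- A nondeterministic choice of tag: reflexivity of saturation keeps `true`, one flip reaches
  -- `false`.
  either : {Z : Set} → Z ⇝ (Bool × Z)
  either z = ((flip ♯) *) (true , z)

  either-true : {Z : Set} → ((true ,_) ♯) ≤ either {Z}
  either-true = ∘-mono (true ,_) (sat-1 (flip ♯))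

  either-false : {Z : Set} → ((false ,_) ♯) ≤ either {Z}
  either-false = ∘-mono (true ,_) (sat-2 (flip ♯))

  -- `flip` fixes the second component, so `proj₂` carries it to `𝟙`, whose saturation adds nothing.
  either-proj₂ : {Z : Set} → fmap proj₂ ∘ either {Z} ≤ 𝟙
  either-proj₂ {Z} = ∘-mono (true ,_) (begin
    fmap proj₂ ∘ (flip ♯) *      ≈⟨ ♯-· proj₂ _ ⟨
    (proj₂ ♯) · ((flip ♯) *)     ≲⟨ sat-5≤ proj₂ (flip ♯) 𝟙 (≗⇒≤ λ w → trans (·-♯ (proj₂ ♯) flip w) (sym (·-♯ 𝟙 proj₂ w))) ⟩
    (𝟙 *) · (proj₂ ♯)            ≈⟨ ·-♯ (𝟙 *) proj₂ ⟩
    𝟙 * ∘ proj₂                  ≲⟨ ∘-mono proj₂ 𝟙*≤𝟙 ⟩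
    𝟙 ∘ proj₂                    ∎)

  choose : {Z Y : Set} → Z ⇝ Y → Z ⇝ Y → Bool → Z ⇝ Y
  choose f g true  = f
  choose f g false = g

  cotuple : {Z Y : Set} → Z ⇝ Y → Z ⇝ Y → (Bool × Z) ⇝ Y
  cotuple f g p = choose f g (proj₁ p) (proj₂ p)

  infixr 6 _⊕_
  _⊕_ : {Z Y : Set} → Z ⇝ Y → Z ⇝ Y → Z ⇝ Y
  f ⊕ g = cotuple f g · either

  f≤f⊕g : {Z Y : Set} (f g : Z ⇝ Y) → f ≤ f ⊕ g
  f≤f⊕g f g = ≤-resp-≗ (·-♯ (cotuple f g) (true ,_)) (λ _ → refl) (·-mono either-true ≤-refl)

  g≤f⊕g : {Z Y : Set} (f g : Z ⇝ Y) → g ≤ f ⊕ g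
  g≤f⊕g f g = ≤-resp-≗ (·-♯ (cotuple f g) (false ,_)) (λ _ → refl) (·-mono either-false ≤-refl)

  -- The tag is chosen before either branch runs, so postcomposition acts on the branches alone.
  fmap-⊕ : {Z Y W : Set} (k : Y → W) (f g : Z ⇝ Y) →
           fmap k ∘ (f ⊕ g) ≗ (fmap k ∘ f) ⊕ (fmap k ∘ g)
  fmap-⊕ k f g z = trans (fmap-· k (cotuple f g) either z) (cong μ (fmap-cong lemma (either z)))
    where
    lemma : fmap k ∘ cotuple f g ≗ cotuple (fmap k ∘ f) (fmap k ∘ g)
    lemma (true  , _) = refl
    lemma (false , _) = refl

  module _ (cot : CotuplingMonotonic S) where

    -- Monotone cotupling enlarges both branches to `h`; the tag is then irrelevant and
    -- `either-proj₂` discards the choice.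
    ⊕-lub : {Z Y : Set} {f g h : Z ⇝ Y} → f ≤ h → g ≤ h → f ⊕ g ≤ h
    ⊕-lub {Z} {Y} {f} {g} {h} f≤h g≤h = begin
      cotuple f g · either        ≲⟨ ·-mono ≤-refl (cot Bool (λ _ → Z) Y (choose f g) (λ _ → h) choose≤) ⟩
      (h ∘ proj₂) · either        ≈⟨ ·-fmap h proj₂ either ⟨
      h · (fmap proj₂ ∘ either)   ≲⟨ ·-mono either-proj₂ ≤-refl ⟩
      h · 𝟙                       ≈⟨ ·-♯ h id ⟩
      h                           ∎
      where
      choose≤ : (b : Bool) → choose f g b ≤ h
      choose≤ true  = f≤h
      choose≤ false = g≤h

    ⊕-monoʳ : {Z Y : Set} (f : Z ⇝ Y) {g h : Z ⇝ Y} → g ≤ h → f ⊕ g ≤ f ⊕ h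
    ⊕-monoʳ f {g} {h} g≤h = ⊕-lub (f≤f⊕g f h) (≤-trans g≤h (g≤f⊕g f h))

-- Cutting a lax lift down to an exact one

module Cut (S : OrderedSaturationMonad)
           (cot : CotuplingMonotonic S) (wlp : WeaklyLaxPreservesPullbacks S) where
  open OrderedSaturationMonad S
  open KleisliOrder S
  open Join S

  ! : {A : Set} → A → ⊤
  ! _ = tt

  fmap-fmap : {X A B C : Set} {g : B → C} {f : A → B} {h : A → C} →
              g ∘ f ≗ h → (u : X ⇝ A) → fmap g ∘ fmap f ∘ u ≗ fmap h ∘ u
  fmap-fmap {g = g} {f} eq u x = trans (sym (fmap-∘ g f (u x))) (fmap-cong eq (u x))

  fmap-fmap-id : {X A B : Set} {g : B → A} {f : A → B} →
                 g ∘ f ≗ id → (u : X ⇝ A) → fmap g ∘ fmap f ∘ u ≗ u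
  fmap-fmap-id eq u x = trans (fmap-fmap eq u x) (fmap-id (u x))

  -- `reduce` forgets the tags, so the tagged join lies over the plain one and can be lifted along a
  -- pullback of `reduce`.
  merge : {Z X : Set} (a b : Z ⇝ X) →
          fmap reduce ∘ ((fmap inj₁ ∘ a) ⊕ (fmap inj₂ ∘ b)) ≗ a ⊕ b
  merge a b z = trans (fmap-⊕ reduce _ _ z) (⊕-cong z)
    where
    ⊕-cong : (fmap reduce ∘ fmap inj₁ ∘ a) ⊕ (fmap reduce ∘ fmap inj₂ ∘ b) ≗ a ⊕ b
    ⊕-cong z = cong μ (fmap-cong eq (either z))
      where
      eq : cotuple (fmap reduce ∘ fmap inj₁ ∘ a) (fmap reduce ∘ fmap inj₂ ∘ b) ≗ cotuple a b
      eq (true  , z) = fmap-fmap-id (λ _ → refl) a z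
      eq (false , z) = fmap-fmap-id (λ _ → refl) b z

  -- T may have constants, which inl and inr do not separate; this is why a must
  -- dominate b over T ⊤.
  inj₁-cancel-≤ : {Z X : Set} (a' a b : Z ⇝ X) →
                  fmap ! ∘ b ≤ fmap ! ∘ a →
                  fmap inj₁ ∘ a' ≤ (fmap inj₁ ∘ a) ⊕ (fmap inj₂ ∘ b) →
                  a' ≤ a
  inj₁-cancel-≤ {Z} {X} a' a b !b≤!a a'≤ = begin
    a'                             ≲⟨ proj₁ (proj₂ lift) ⟩
    fmap (pb₁ S) ∘ ξ               ≈⟨ fmap-fmap reduce-pb₂ ξ ⟨
    fmap reduce ∘ fmap (pb₂ S) ∘ ξ ≲⟨ fmap-mono reduce (proj₂ (proj₂ lift)) ⟩
    fmap reduce ∘ ((fmap inj₁ ∘ a) ⊕ (fmap inj₂ ∘ a)) ≈⟨ merge a a ⟩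
    a ⊕ a                          ≲⟨ ⊕-lub cot ≤-refl ≤-refl ⟩
    a                              ∎
    where
    -- Shrinking the right summand to a point leaves of `b` only its image over `T ⊤`, which `a`
    -- dominates; hence `b` can be replaced by `a`.
    c : X ⊎ X → X ⊎ ⊤
    c = ⊎-map id !

    c-⊕ : (d : Z ⇝ X) → fmap c ∘ ((fmap inj₁ ∘ a) ⊕ (fmap inj₂ ∘ d)) ≗
                        (fmap c ∘ fmap inj₁ ∘ a) ⊕ (fmap c ∘ fmap inj₂ ∘ d)
    c-⊕ d = fmap-⊕ c (fmap inj₁ ∘ a) (fmap inj₂ ∘ d)

    c-inj₂ : (d : Z ⇝ X) → fmap c ∘ fmap inj₂ ∘ d ≗ fmap inj₂ ∘ fmap ! ∘ d
    c-inj₂ d z = trans (fmap-fmap (λ _ → refl) d z) (sym (fmap-fmap (λ _ → refl) d z))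

    ca'≤ : fmap inj₁ ∘ a' ≤ fmap c ∘ ((fmap inj₁ ∘ a) ⊕ (fmap inj₂ ∘ a))
    ca'≤ = begin
      fmap inj₁ ∘ a'                                        ≈⟨ fmap-fmap (λ _ → refl) a' ⟨
      fmap c ∘ fmap inj₁ ∘ a'                               ≲⟨ fmap-mono c a'≤ ⟩
      fmap c ∘ ((fmap inj₁ ∘ a) ⊕ (fmap inj₂ ∘ b))          ≈⟨ c-⊕ b ⟩
      (fmap c ∘ fmap inj₁ ∘ a) ⊕ (fmap c ∘ fmap inj₂ ∘ b)   ≲⟨ ⊕-monoʳ cot _
        (≤-resp-≗ (λ z → sym (c-inj₂ b z)) (λ z → sym (c-inj₂ a z)) (fmap-mono inj₂ !b≤!a)) ⟩
      (fmap c ∘ fmap inj₁ ∘ a) ⊕ (fmap c ∘ fmap inj₂ ∘ a)   ≈⟨ c-⊕ a ⟨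
      fmap c ∘ ((fmap inj₁ ∘ a) ⊕ (fmap inj₂ ∘ a))          ∎

    lift = proj₂ (wlp inj₁ c) Z a' _ ca'≤
    ξ = proj₁ lift

    -- A right summand is impossible here: `c` would send it to `inj₂ tt`, which is no value of
    -- `inj₁`.
    reduce-pb₂ : (p : Pullback S inj₁ c) → reduce (pb₂ S p) ≡ pb₁ S p
    reduce-pb₂ ((_ , inj₁ _) , refl) = refl

  cut : {Z B X : Set} (π : B → X) (a : Z ⇝ X) (δ : Z ⇝ B) →
        a ≤ fmap π ∘ δ → fmap ! ∘ fmap π ∘ δ ≤ fmap ! ∘ a →
        Σ (Z ⇝ B) λ z → z ≤ δ × (fmap π ∘ z ≗ a)
  cut {Z} {B} {X} π a δ a≤b !b≤!a = z , z≤δ , λ i → trans (πz≗a' i) (≤-antisym a'≤a a≤a' i)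
    where
    b : Z ⇝ X
    b = fmap π ∘ δ

    q : Z ⇝ (X ⊎ X)
    q = (fmap inj₁ ∘ a) ⊕ (fmap inj₂ ∘ b)

    -- Since `a ≤ b`, the join `a ⊕ b` equals `b`, so `q` and `δ` have the same image in `T X` and
    -- lift jointly to the pullback.
    strict = proj₁ (wlp reduce π) Z q δ λ i →
      trans (merge a b i) (≤-antisym (⊕-lub cot a≤b ≤-refl) (g≤f⊕g a b) i)

    ζ : Z ⇝ Pullback S reduce π
    ζ = proj₁ strict

    p₁ : Pullback S reduce π → X ⊎ X
    p₁ = pb₁ S

    p₂ : Pullback S reduce π → B
    p₂ = pb₂ S

    p₁ζ : fmap p₁ ∘ ζ ≗ q
    p₁ζ = proj₁ (proj₂ strict)

    -- The left part of `q` selects the part of `ζ` tagged `inj₁`, up to inequality.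
    lax = proj₂ (wlp inj₁ p₁) Z a ζ
      (≤-resp-≗ (λ _ → refl) (λ i → sym (p₁ζ i)) (f≤f⊕g (fmap inj₁ ∘ a) (fmap inj₂ ∘ b)))

    ξ : Z ⇝ Pullback S inj₁ p₁
    ξ = proj₁ lax

    a' : Z ⇝ X
    a' = fmap (pb₁ S) ∘ ξ

    a≤a' : a ≤ a'
    a≤a' = proj₁ (proj₂ lax)

    ξ≤ζ : fmap (pb₂ S) ∘ ξ ≤ ζ
    ξ≤ζ = proj₂ (proj₂ lax)

    z : Z ⇝ B
    z = fmap p₂ ∘ fmap (pb₂ S) ∘ ξ

    z≤δ : z ≤ δ
    z≤δ = ≤-resp-≗ (λ _ → refl) (proj₂ (proj₂ strict)) (fmap-mono p₂ ξ≤ζ)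

    π-pb : (p : Pullback S inj₁ p₁) → π (p₂ (pb₂ S p)) ≡ pb₁ S p
    π-pb ((_ , (_ , e)) , refl) = sym e

    πz≗a' : fmap π ∘ z ≗ a'
    πz≗a' i = trans (fmap-fmap (λ _ → refl) (fmap (pb₂ S) ∘ ξ) i) (fmap-fmap π-pb ξ i)

    -- Passing to a smaller map could still have left `a'` too big; its tagged form lies below `q`,
    -- so cancellation applies.
    a'≤a : a' ≤ a
    a'≤a = inj₁-cancel-≤ a' a b !b≤!a (begin
      fmap inj₁ ∘ fmap (pb₁ S) ∘ ξ  ≈⟨ fmap-fmap (λ _ → refl) ξ ⟩
      fmap (inj₁ ∘ pb₁ S) ∘ ξ       ≈⟨ fmap-fmap (λ p → sym (proj₂ p)) ξ ⟨
      fmap p₁ ∘ fmap (pb₂ S) ∘ ξ    ≲⟨ fmap-mono p₁ ξ≤ζ ⟩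
      fmap p₁ ∘ ζ                   ≈⟨ p₁ζ ⟩
      q                             ∎)

-- Passing between weak and strong bisimulations

module Bisimulations (S : OrderedSaturationMonad) {X : Set}
                     (α : OrderedSaturationMonad._⇝_ S X X) where
  open OrderedSaturationMonad S
  open KleisliOrder S

  module _ (cot : CotuplingMonotonic S) (wlp : WeaklyLaxPreservesPullbacks S) where
    open Cut S cot wlp

    weak⇒strong : (R : Rel S X) → IsWeakBisim S α R → IsStrongBisim S (α *) R
    weak⇒strong R (symR , γ , απ₁≤π₁γ , π₂γ≤α*π₂) =
      ρ , ≤-antisym ρ₁≤ ρ₁≥ , ≤-antisym ρ₂≤ ρ₂≥
      where
      E : Set
      E = ∣_∣ S R

      p₁ p₂ : E → X
      p₁ = π₁ S
      p₂ = π₂ S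

      σ : E → E
      σ ((x , y) , r) = (y , x) , symR r

      δ : E ⇝ E
      δ = γ *

      δ₁ : α * ∘ p₁ ≤ fmap p₁ ∘ δ
      δ₁ = fmap-*-≥ p₁ γ α (≤-resp-≗ (·-♯ α p₁) (♯-· p₁ γ) απ₁≤π₁γ)

      δ₂ : fmap p₂ ∘ δ ≤ α * ∘ p₂
      δ₂ = fmap-*-≤ p₂ γ α (≤-resp-≗ (♯-· p₂ γ) (·-♯ (α *) p₂) π₂γ≤α*π₂)

      !δ≤ : fmap ! ∘ fmap p₁ ∘ δ ≤ fmap ! ∘ α * ∘ p₂
      !δ≤ = begin
        fmap ! ∘ fmap p₁ ∘ δ ≈⟨ fmap-fmap (λ _ → refl) δ ⟩
        fmap ! ∘ δ           ≈⟨ fmap-fmap (λ _ → refl) δ ⟨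
        fmap ! ∘ fmap p₂ ∘ δ ≲⟨ fmap-mono ! δ₂ ⟩
        fmap ! ∘ α * ∘ p₂    ∎

      simulation : Σ (E ⇝ E) λ z → z ≤ δ × (fmap p₁ ∘ z ≗ α * ∘ p₁)
      simulation = cut p₁ (α * ∘ p₁) δ δ₁
        -- Over `T ⊤` the two projections of `δ` agree. Since `p₂` is `p₁ ∘ σ`, running the
        -- comparison once more at the swapped pair turns the bound by `α * ∘ p₂` into one by
        -- `α * ∘ p₁`.
        (≤-trans !δ≤ (∘-mono σ (≤-trans (fmap-mono ! δ₁) !δ≤)))

      z z' : E ⇝ E
      z = proj₁ simulation
      z' = fmap σ ∘ z ∘ σ

      z₁ : fmap p₁ ∘ z ≗ α * ∘ p₁
      z₁ = proj₂ (proj₂ simulation)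

      z₂ : fmap p₂ ∘ z ≤ α * ∘ p₂
      z₂ = ≤-trans (fmap-mono p₂ (proj₁ (proj₂ simulation))) δ₂

      z'₁ : fmap p₁ ∘ z' ≤ α * ∘ p₁
      z'₁ = ≤-resp-≗ (λ e → sym (fmap-fmap (λ _ → refl) (z ∘ σ) e)) (λ _ → refl) (∘-mono σ z₂)

      z'₂ : fmap p₂ ∘ z' ≗ α * ∘ p₂
      z'₂ e = trans (fmap-fmap (λ _ → refl) (z ∘ σ) e) (z₁ (σ e))

      -- `z` is exact on the first projection and `z'` on the second. Reflexivity of saturation puts
      -- both below the composite, and transitivity of `α *` keeps both projections of it below
      -- `α *`.
      ρ : E ⇝ E
      ρ = (z' *) · (z *)

      ρ-upper : (p : E → X) → fmap p ∘ z ≤ α * ∘ p → fmap p ∘ z' ≤ α * ∘ p →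
                fmap p ∘ ρ ≤ α * ∘ p
      ρ-upper p pz pz' = begin
        fmap p ∘ ρ               ≈⟨ fmap-· p (z' *) (z *) ⟩
        (fmap p ∘ z' *) · (z *)  ≲⟨ ·-mono ≤-refl (fmap-*-≤ p z' α pz') ⟩
        (α * ∘ p) · (z *)        ≈⟨ ·-fmap (α *) p (z *) ⟨
        (α *) · (fmap p ∘ z *)   ≲⟨ ·-mono (fmap-*-≤ p z α pz) ≤-refl ⟩
        (α *) · (α * ∘ p)        ≲⟨ ∘-mono p (sat-3 α) ⟩
        α * ∘ p                  ∎

      ρ₁≤ : fmap p₁ ∘ ρ ≤ α * ∘ p₁
      ρ₁≤ = ρ-upper p₁ (≗⇒≤ z₁) z'₁

      ρ₂≤ : fmap p₂ ∘ ρ ≤ α * ∘ p₂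
      ρ₂≤ = ρ-upper p₂ z₂ (≗⇒≤ z'₂)

      z≤ρ : z ≤ ρ
      z≤ρ = ≤-resp-≗ (·-identityˡ z) (λ _ → refl) (·-mono (sat-2 z) (sat-1 z'))

      z'≤ρ : z' ≤ ρ
      z'≤ρ = ≤-resp-≗ (·-♯ z' id) (λ _ → refl) (·-mono (sat-1 z) (sat-2 z'))

      ρ₁≥ : α * ∘ p₁ ≤ fmap p₁ ∘ ρ
      ρ₁≥ = ≤-resp-≗ z₁ (λ _ → refl) (fmap-mono p₁ z≤ρ)

      ρ₂≥ : α * ∘ p₂ ≤ fmap p₂ ∘ ρ
      ρ₂≥ = ≤-resp-≗ z'₂ (λ _ → refl) (fmap-mono p₂ z'≤ρ)

  -- Strong bisimulations need not be symmetric, so the converse is adjoined.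
  symmetrise : Rel S X → Rel S X
  symmetrise R x y = R x y ⊎ R y x

  -- On a reversed pair the witness is `γ` at the original pair with coordinates swapped, so `γ₁`
  -- and `γ₂` exchange roles. Both projections stay exact for `α *`, and `α ≤ α *` gives the lower
  -- bound.
  strong⇒weak : (R : Rel S X) → IsStrongBisim S (α *) R → IsWeakBisim S α (symmetrise R)
  strong⇒weak R (γ , γ₁ , γ₂) =
    (λ { (inj₁ r) → inj₂ r ; (inj₂ r) → inj₁ r }) , γ' , lower , upper
    where
    E E' : Set
    E = ∣_∣ S R
    E' = ∣_∣ S (symmetrise R)

    ι ι' : E → E'
    ι  ((x , y) , r) = (x , y) , inj₁ r
    ι' ((x , y) , r) = (y , x) , inj₂ r

    γ' : E' ⇝ E'
    γ' ((x , y) , inj₁ r) = fmap ι  (γ ((x , y) , r))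
    γ' ((x , y) , inj₂ r) = fmap ι' (γ ((y , x) , r))

    p₁ p₂ : E' → X
    p₁ = π₁ S
    p₂ = π₂ S

    γ'₁ : fmap p₁ ∘ γ' ≗ α * ∘ p₁
    γ'₁ ((x , y) , inj₁ r) = trans (sym (fmap-∘ p₁ ι _)) (γ₁ _)
    γ'₁ ((x , y) , inj₂ r) = trans (sym (fmap-∘ p₁ ι' _)) (γ₂ _)

    γ'₂ : fmap p₂ ∘ γ' ≗ α * ∘ p₂
    γ'₂ ((x , y) , inj₁ r) = trans (sym (fmap-∘ p₂ ι _)) (γ₂ _)
    γ'₂ ((x , y) , inj₂ r) = trans (sym (fmap-∘ p₂ ι' _)) (γ₁ _)

    lower : α · (p₁ ♯) ≤ (p₁ ♯) · γ'
    lower = begin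
      α · (p₁ ♯)    ≈⟨ ·-♯ α p₁ ⟩
      α ∘ p₁        ≲⟨ ∘-mono p₁ (sat-2 α) ⟩
      α * ∘ p₁      ≈⟨ γ'₁ ⟨
      fmap p₁ ∘ γ'  ≈⟨ ♯-· p₁ γ' ⟨
      (p₁ ♯) · γ'   ∎

    upper : (p₂ ♯) · γ' ≤ (α *) · (p₂ ♯)
    upper = ≗⇒≤ λ e → trans (♯-· p₂ γ' e) (trans (γ'₂ e) (sym (·-♯ (α *) p₂ e)))

theorem6p8 : (S : OrderedSaturationMonad) →
    CotuplingMonotonic S → WeaklyLaxPreservesPullbacks S →
    {X : Set} (α : X → OrderedSaturationMonad.T S X) (x y : X) →
    (WeakBisimilar S α x y → StronglyBisimilar S (OrderedSaturationMonad._* S α) x y) ×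
    (StronglyBisimilar S (OrderedSaturationMonad._* S α) x y → WeakBisimilar S α x y)
theorem6p8 S cot wlp α x y =
  (λ { (R , weak , r) → R , weak⇒strong cot wlp R weak , r }) ,
  (λ { (R , strong , r) → symmetrise R , strong⇒weak R strong , inj₁ r })
  where open Bisimulations S α
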